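{- Let $a, b, n, t$ be integers with $n\geq 1$ and $t\geq 1$. The congruence $ax \equiv b \pmod{n}$ has at least one solution $x$ with $(x,n)=t$ if and only if $t\mid(b,n)$ and $\left(a,\frac{n}{t}\right)=\left(\frac{b}{t},\frac{n}{t}\right)$. Furthermore, if these conditions are satisfied, then there are exactly $$\frac{\varphi\left(\frac{n}{t}\right)}{\varphi\left(\frac{n}{td}\right)}= d \prod_{\substack{p\, \mid\, d\\ p\, \nmid\, \frac{n}{td}}}\left(1-\frac1{p} \right)$$ solutions $x$ modulo $n$ with $(x,n)=t$, where $p$ ranges over the primes and $d = \left(a,\frac{n}{t}\right)=\left(\frac{b}{t},\frac{n}{t}\right)$.
   Context: $(u,v)$ denotes the (nonnegative) greatest common divisor of integers $u,v$, with $(0,v)=|v|$. $\varphi$ is Euler's totient function. Solutions are counted modulo $n$, i.e. as residue classes in $\mathbb{Z}_n=\mathbb{Z}/n\mathbb{Z}$ (note that $(x,n)$ depends only on $x$ modulo $n$). An empty product equals $1$. -}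

module Defs where

open import Data.Fin.Base using (Fin; toℕ)
open import Data.Integer.Base as ℤ using (ℤ; +_)
open import Data.Integer.Divisibility.Signed as ℤ using (∣⇒∣ᵤ)
open import Data.Integer.GCD using (gcd; gcd[i,j]∣j)
import Data.Integer.Properties as ℤ
open import Data.List.Base using (List; allFin; applyUpTo; filter; foldr; length; map; upTo)
open import Data.List.Properties using (filter-accept)
open import Data.Nat.Base using (ℕ; suc; NonZero; _*_; _/_; ≢-nonZero; ≢-nonZero⁻¹)
open import Data.Nat.Coprimality using (coprime?; 1-coprimeTo)
open import Data.Nat.Divisibility using (_∣_; _∣?_; ∣-trans; m∣n/o⇒o*m∣n; n/m≡quotient; quotient≢0)
open import Data.Nat.GCD using (gcd[m,n]∣n; gcd[m,n]≢0)
open import Data.Nat.Primality using (prime?)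
open import Data.Nat.Properties using (m*n≢0)
open import Data.Product.Base using (_×_)
open import Data.Rational.Base as ℚ using (ℚ; 1ℚ)
open import Data.Sum.Base using (inj₂)
open import Relation.Binary.PropositionalEquality using (_≡_; sym; subst)
open import Relation.Nullary.Decidable using (Dec; _×-dec_; ¬?)

infix 4 _≡_[mod_]

_≡_[mod_] : ℤ → ℤ → ℕ → Set
x ≡ y [mod n ] = + n ℤ.∣ x ℤ.- y

-- x solves a x ≡ b (mod n) and (x , n) = t.
IsSolution : (a b : ℤ) (n t : ℕ) → ℤ → Set
IsSolution a b n t x = (a ℤ.* x ≡ b [mod n ]) × (gcd x (+ n) ≡ + t)

isSolution? : ∀ a b n t x → Dec (IsSolution a b n t x)
isSolution? a b n t x =
  (+ n ℤ.∣? a ℤ.* x ℤ.- b) ×-dec (gcd x (+ n) ℤ.≟ + t)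

-- The solutions modulo n are counted on the representatives 0, …, n - 1 of the
-- residue classes.
#solutions : (a b : ℤ) (n t : ℕ) → ℕ
#solutions a b n t =
  length (filter (λ (r : Fin n) → isSolution? a b n t (+ toℕ r)) (allFin n))

-- The number of k ∈ {1, …, n} coprime to n.
φ : ℕ → ℕ
φ n = length (filter (λ k → coprime? k n) (map suc (upTo n)))

∏ℚ : List ℚ → ℚ
∏ℚ = foldr ℚ._*_ 1ℚ

-- ∏ (1 - 1/p) over the primes p with p ∣ d and p ∤ m, for d ≥ 1.  As p ≤ d,
-- writing p = suc k lets k range over {0, …, d - 1} and makes p visibly nonzero.
∏[1-1/p] : (d m : ℕ) → ℚ
∏[1-1/p] d m =
  ∏ℚ (map (λ k → 1ℚ ℚ.- (+ 1 ℚ./ suc k))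
          (filter (λ k → prime? (suc k) ×-dec (suc k ∣? d) ×-dec ¬? (suc k ∣? m))
                  (upTo d)))

-- The denominators n/(td), φ(n/(td)) of the formula are well defined.

φ≢0 : ∀ n .{{_ : NonZero n}} → NonZero (φ n)
φ≢0 n@(suc m)
  rewrite filter-accept (λ k → coprime? k n) {xs = map suc (applyUpTo suc m)} (1-coprimeTo n) = _

n/t≢0 : ∀ {n t} .{{_ : NonZero n}} .{{_ : NonZero t}} → t ∣ n → NonZero (n / t)
n/t≢0 t∣n = subst NonZero (sym (n/m≡quotient t∣n)) (quotient≢0 t∣n)

∣[b,n]⇒∣n : ∀ b {n t} → + t ℤ.∣ gcd b (+ n) → t ∣ n
∣[b,n]⇒∣n b {n} t∣[b,n] = ∣-trans (∣⇒∣ᵤ t∣[b,n]) (gcd[i,j]∣j b (+ n))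

t*d≢0 : ∀ a {n t} .{{_ : NonZero n}} .{{_ : NonZero t}} → t ∣ n →
        NonZero (t * ℤ.∣ gcd a (+ (n / t)) ∣)
t*d≢0 a {n} {t} t∣n = m*n≢0 t _
  where
  instance
    _ = n/t≢0 t∣n
    _ = ≢-nonZero (gcd[m,n]≢0 ℤ.∣ a ∣ (n / t) (inj₂ (≢-nonZero⁻¹ (n / t))))

n/[t*d]≢0 : ∀ a {n t} .{{_ : NonZero n}} .{{_ : NonZero t}} (t∣n : t ∣ n) →
            NonZero ((n / (t * ℤ.∣ gcd a (+ (n / t)) ∣)) {{t*d≢0 a t∣n}})
n/[t*d]≢0 a {n} {t} t∣n = n/t≢0 (m∣n/o⇒o*m∣n t∣n (gcd[m,n]∣n ℤ.∣ a ∣ (n / t)))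
  where instance _ = t*d≢0 a t∣n

{-# OPTIONS --safe #-}

-- Write n = t m.  The x with (x , n) = t are the t y with (y , m) = 1, and then
-- a x ≡ b (mod n) reads a y ≡ b/t (mod m), whence (a , m) = (b/t , m) =: d.
-- With m = d e, dividing by d leaves a congruence with invertible coefficients
-- modulo e, that is, y ≡ c (mod e) for a single c coprime to e.  It remains to
-- count the k < d with c + e k coprime to d e, which amounts to sieving by the
-- primes p ∣ d with p ∤ e.  Each of them keeps a proportion 1 - 1/p of the k,
-- whatever c is, so summing over all c coprime to e gives φ(m) as φ(e) times
-- the same number.
module Submission where

open import Defs
open import Algebra.Properties.CommutativeSemigroup using (interchange)
open import Data.Bool.Base using (if_then_else_; true; false)
open import Data.Fin.Base as Fin using (Fin; toℕ)
open import Data.Integer.Base as ℤ using (ℤ; +_; -[1+_]; ∣_∣; _/ℕ_)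
open import Data.Integer.Divisibility.Signed as ℤ using (_∣_; divides; ∣⇒∣ᵤ; ∣ᵤ⇒∣)
open import Data.Integer.DivMod as ℤ using (_%ℕ_; n%ℕd<d; a≡a%ℕn+[a/ℕn]*n)
open import Data.Integer.GCD using (gcd)
import Data.Integer.Properties as ℤ
open import Data.Integer.Tactic.RingSolver using (solve-∀)
open import Data.List.Base using (List; []; _∷_; allFin; applyUpTo; filter; length; map; tabulate; upTo)
open import Data.List.Membership.Propositional using (_∈_)
open import Data.List.Membership.Propositional.Properties using (∈-filter⁺; ∈-filter⁻; ∈-upTo⁺)
open import Data.List.Properties using (map-applyUpTo)
open import Data.List.Relation.Unary.All as All using (All; []; _∷_)
open import Data.List.Relation.Unary.All.Properties using (all-filter)
open import Data.List.Relation.Unary.AllPairs using ([]; _∷_)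
open import Data.List.Relation.Unary.Unique.Propositional using (Unique)
open import Data.List.Relation.Unary.Unique.Propositional.Properties using (filter⁺; upTo⁺)
open import Data.Nat.Base as ℕ using (ℕ; zero; suc; NonZero; _+_; _*_; _/_; _<_; s≤s; z<s; s<s)
open import Data.Nat.Coprimality as Coprime using (Coprime; coprime?; coprime-Bézout)
open import Data.Nat.Divisibility as ℕ using (_∤_)
open import Data.Nat.DivMod using (m/n*n≡m; m*[n/m]≡n; m/n/o≡m/[n*o])
open import Data.Nat.GCD as ℕ using (module Bézout)
open import Data.Nat.Primality using (Prime; prime?; euclidsLemma; prime⇒irreducible; ¬prime[0]; ¬prime[1])
open import Data.Nat.Primality.Factorisation using (PrimeFactorisation; factorise)
import Data.Nat.Properties as ℕ
open import Data.Product.Base using (_×_; _,_; ∃-syntax; proj₁; proj₂)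
open import Data.Rational.Base as ℚ using (ℚ; 1ℚ)
import Data.Rational.Properties as ℚ
open import Data.Rational.Solver using (module +-*-Solver)
open import Data.Rational.Unnormalised.Base as ℚᵘ using (mkℚᵘ; *≡*)
import Data.Rational.Unnormalised.Properties as ℚᵘ
open import Data.Sum.Base using (inj₁; inj₂)
open import Function.Base using (_∘_; id)
open import Function.Bundles using (_⇔_; mk⇔; module Equivalence)
open import Function.Construct.Composition using (_⇔-∘_)
open import Level using (0ℓ)
open import Relation.Binary.PropositionalEquality
open import Relation.Nullary using (Dec; yes; no; does; ¬_; contradiction)
open import Relation.Nullary.Decidable using (_×-dec_; ¬?; does-⇔; dec-false)
open import Relation.Unary using (Pred; Decidable)

open ≡-Reasoning
open Equivalence using (to; from)

-- Sums over initial segments and residue classes.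

Σ : ℕ → (ℕ → ℕ) → ℕ
Σ zero    f = 0
Σ (suc n) f = f 0 + Σ n (f ∘ suc)

Σ-cong : ∀ n {f g} → (∀ {k} → k < n → f k ≡ g k) → Σ n f ≡ Σ n g
Σ-cong zero    f≡g = refl
Σ-cong (suc n) f≡g = cong₂ _+_ (f≡g z<s) (Σ-cong n (f≡g ∘ s<s))

Σ-zero : ∀ n {f} → (∀ {k} → k < n → f k ≡ 0) → Σ n f ≡ 0
Σ-zero zero    f≡0 = refl
Σ-zero (suc n) f≡0 = cong₂ _+_ (f≡0 z<s) (Σ-zero n (f≡0 ∘ s<s))

Σ-+ : ∀ n f g → Σ n (λ k → f k + g k) ≡ Σ n f + Σ n g
Σ-+ zero    f g = refl
Σ-+ (suc n) f g = trans
  (cong ((f 0 + g 0) ℕ.+_) (Σ-+ n (f ∘ suc) (g ∘ suc)))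
  (interchange ℕ.+-commutativeSemigroup (f 0) (g 0) (Σ n (f ∘ suc)) (Σ n (g ∘ suc)))

Σ-*ʳ : ∀ n f c → Σ n (λ k → f k * c) ≡ Σ n f * c
Σ-*ʳ zero    f c = refl
Σ-*ʳ (suc n) f c = trans (cong ((f 0 * c) ℕ.+_) (Σ-*ʳ n (f ∘ suc) c)) (sym (ℕ.*-distribʳ-+ c (f 0) _))

Σ-++ : ∀ m n f → Σ (m + n) f ≡ Σ m f + Σ n (λ k → f (m + k))
Σ-++ zero    n f = refl
Σ-++ (suc m) n f = trans (cong (f 0 ℕ.+_) (Σ-++ m n (f ∘ suc))) (sym (ℕ.+-assoc (f 0) _ _))

-- Both sides plus `f 0` are `Σ (suc n) f`, which is split once at its first term and once at its
-- last. This passes from the range {1, ..., n} to {0, ..., n - 1}.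
Σ-shift : ∀ n f → f n ≡ f 0 → Σ n (f ∘ suc) ≡ Σ n f
Σ-shift n f fn≡f0 = ℕ.+-cancelˡ-≡ (f 0) _ _ (begin
  Σ (suc n) f                 ≡⟨ cong (λ m → Σ m f) (ℕ.+-comm 1 n) ⟩
  Σ (n + 1) f                 ≡⟨ Σ-++ n 1 f ⟩
  Σ n f + (f (n + 0) + 0)     ≡⟨ cong (Σ n f ℕ.+_) (ℕ.+-identityʳ _) ⟩
  Σ n f + f (n + 0)           ≡⟨ cong (λ k → Σ n f + f k) (ℕ.+-identityʳ n) ⟩
  Σ n f + f n                 ≡⟨ cong (Σ n f ℕ.+_) fn≡f0 ⟩
  Σ n f + f 0                 ≡⟨ ℕ.+-comm _ (f 0) ⟩
  f 0 + Σ n f                 ∎)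

Σ-single : ∀ {n c} f → c < n → (∀ {k} → k < n → k ≢ c → f k ≡ 0) → Σ n f ≡ f c
Σ-single {suc n} {zero}  f _         f≡0 =
  trans (cong (f 0 ℕ.+_) (Σ-zero n (λ k<n → f≡0 (s<s k<n) λ ()))) (ℕ.+-identityʳ (f 0))
Σ-single {suc n} {suc c} f (s≤s c<n) f≡0 = cong₂ _+_ (f≡0 z<s λ ())
  (Σ-single (f ∘ suc) c<n (λ k<n k≢c → f≡0 (s<s k<n) (k≢c ∘ ℕ.suc-injective)))

-- Division with remainder by e: each x < d e is s + e k with s < e and k < d. The induction peels
-- off the first block of e terms, which is k = 0.
Σ-* : ∀ d e f → Σ (d * e) f ≡ Σ e (λ s → Σ d (λ k → f (s + e * k)))
Σ-* zero    e f = sym (Σ-zero e (λ _ → refl))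
Σ-* (suc d) e f = begin
  Σ (e + d * e) f
    ≡⟨ Σ-++ e (d * e) f ⟩
  Σ e f + Σ (d * e) (f ∘ (e ℕ.+_))
    ≡⟨ cong₂ _+_ (Σ-cong e (λ {s} _ → cong f (s≡s+e*0 s))) (Σ-* d e (f ∘ (e ℕ.+_))) ⟩
  Σ e (λ s → f (s + e * 0)) + Σ e (λ s → Σ d (λ k → f (e + (s + e * k))))
    ≡⟨ cong (_ ℕ.+_) (Σ-cong e (λ {s} _ → Σ-cong d (λ {k} _ → cong f (e+[s+e*k]≡s+e*[1+k] s k)))) ⟩
  Σ e (λ s → f (s + e * 0)) + Σ e (λ s → Σ d (λ k → f (s + e * suc k)))
    ≡⟨ Σ-+ e _ _ ⟨
  Σ e (λ s → Σ (suc d) (λ k → f (s + e * k)))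
    ∎
  where
  s≡s+e*0 : ∀ s → s ≡ s + e * 0
  s≡s+e*0 s = sym (trans (cong (s ℕ.+_) (ℕ.*-zeroʳ e)) (ℕ.+-identityʳ s))

  e+[s+e*k]≡s+e*[1+k] : ∀ s k → e + (s + e * k) ≡ s + e * suc k
  e+[s+e*k]≡s+e*[1+k] s k = begin
    e + (s + e * k)  ≡⟨ ℕ.+-assoc e s _ ⟨
    e + s + e * k    ≡⟨ cong (_+ e * k) (ℕ.+-comm e s) ⟩
    s + e + e * k    ≡⟨ ℕ.+-assoc s e _ ⟩
    s + (e + e * k)  ≡⟨ cong (s ℕ.+_) (ℕ.*-suc e k) ⟨
    s + e * suc k    ∎

-- The distance between r and s is at most their maximum, hence below e, and 0 is the only multiple
-- of e in that range.
residue-unique : ∀ {e r s} → r < e → s < e → + e ∣ + r ℤ.- + s → r ≡ s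
residue-unique {e} {r} {s} r<e s<e e∣r-s
  with ∣ + r ℤ.- + s ∣ in eq
... | zero  = ℤ.+-injective (ℤ.i-j≡0⇒i≡j (+ r) (+ s) (ℤ.∣i∣≡0⇒i≡0 eq))
... | suc _ = contradiction (∣⇒∣ᵤ e∣r-s) (ℕ.>⇒∤ {{subst NonZero (sym eq) _}} ∣r-s∣<e)
  where
  ∣r-s∣<e : ∣ + r ℤ.- + s ∣ < e
  ∣r-s∣<e = ℕ.≤-<-trans
    (subst (λ i → ∣ i ∣ ℕ.≤ r ℕ.⊔ s) (sym (ℤ.m-n≡m⊖n r s)) (ℤ.∣m⊝n∣≤m⊔n r s))
    (ℕ.⊔-lub r<e s<e)

pos-affine : ∀ c e k → + (c + e * k) ≡ + c ℤ.+ + e ℤ.* + k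
pos-affine c e k = trans (ℤ.pos-+ c (e * k)) (cong (λ i → + c ℤ.+ i) (ℤ.pos-* e k))

progression-∣ : ∀ c e k → + e ∣ + (c + e * k) ℤ.- + c
progression-∣ c e k = divides (+ k) (trans (cong (ℤ._- + c) (pos-affine c e k)) (lemma (+ c) (+ e) (+ k)))
  where
  lemma : ∀ c e k → c ℤ.+ e ℤ.* k ℤ.- c ≡ k ℤ.* e
  lemma = solve-∀

-- After `Σ-*` the outer sum runs over residues modulo e, and only the residue c survives. It serves
-- three times: for the multiples of a prime in a progression, for the x divisible by t, and for the
-- solutions of a linear congruence.
Σ-residue : ∀ d {e c} f → c < e → (∀ x → ¬ + e ∣ + x ℤ.- + c → f x ≡ 0) →
            Σ (d * e) f ≡ Σ d (λ k → f (c + e * k))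
Σ-residue d {e} {c} f c<e f≡0 = trans (Σ-* d e f)
  (Σ-single _ c<e λ {s} s<e s≢c → Σ-zero d λ {k} _ → f≡0 (s + e * k) λ e∣ →
    s≢c (residue-unique s<e c<e (ℤ.∣m+n∣n⇒∣m
      (subst (+ e ∣_) (trans (cong (ℤ._- + c) (pos-affine s e k)) (rearrange (+ s) (+ e) (+ k) (+ c))) e∣)
      (ℤ.∣m⇒∣m*n (+ k) ℤ.∣-refl))))
  where
  rearrange : ∀ s e k c → s ℤ.+ e ℤ.* k ℤ.- c ≡ s ℤ.- c ℤ.+ e ℤ.* k
  rearrange = solve-∀

-- Indicators, and lengths of filtered lists as sums.

𝟙 : ∀ {p} {P : Set p} → Dec P → ℕ
𝟙 P? = if does P? then 1 else 0

module _ {p q} {P : Set p} {Q : Set q} where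

  𝟙-cong : P ⇔ Q → (P? : Dec P) (Q? : Dec Q) → 𝟙 P? ≡ 𝟙 Q?
  𝟙-cong P⇔Q P? Q? = cong (if_then 1 else 0) (does-⇔ P⇔Q P? Q?)

  𝟙-¬×+𝟙-× : (P? : Dec P) (Q? : Dec Q) → 𝟙 (¬? P? ×-dec Q?) + 𝟙 (P? ×-dec Q?) ≡ 𝟙 Q?
  𝟙-¬×+𝟙-× (no _)  Q? = ℕ.+-identityʳ _
  𝟙-¬×+𝟙-× (yes _) Q? = refl

𝟙-false : ∀ {p} {P : Set p} (P? : Dec P) → ¬ P → 𝟙 P? ≡ 0
𝟙-false P? ¬p = cong (if_then 1 else 0) (dec-false P? ¬p)

module _ {a p} {A : Set a} {P : Pred A p} (P? : Decidable P) where

  length-filter-∷ : ∀ x xs → length (filter P? (x ∷ xs)) ≡ 𝟙 (P? x) + length (filter P? xs)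
  length-filter-∷ x xs with does (P? x)
  ... | true  = refl
  ... | false = refl

  length-filter-tabulate : ∀ {n} (g : Fin n → A) f → (∀ i → 𝟙 (P? (g i)) ≡ f (toℕ i)) →
                           length (filter P? (tabulate g)) ≡ Σ n f
  length-filter-tabulate {zero}  g f eq = refl
  length-filter-tabulate {suc n} g f eq = trans (length-filter-∷ _ _)
    (cong₂ _+_ (eq Fin.zero) (length-filter-tabulate (g ∘ Fin.suc) (f ∘ suc) (eq ∘ Fin.suc)))

  length-filter-applyUpTo : ∀ g n → length (filter P? (applyUpTo g n)) ≡ Σ n (λ k → 𝟙 (P? (g k)))
  length-filter-applyUpTo g zero    = refl
  length-filter-applyUpTo g (suc n) = trans (length-filter-∷ _ _)
    (cong (𝟙 (P? (g 0)) ℕ.+_) (length-filter-applyUpTo (g ∘ suc) n))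

  length-filter≢0 : ∀ xs → length (filter P? xs) ≢ 0 → ∃[ x ] P x
  length-filter≢0 xs ≢0 with filter P? xs | all-filter P? xs
  ... | []    | _      = contradiction refl ≢0
  ... | x ∷ _ | px ∷ _ = x , px

-- The definition counts on {1, ..., n}, while residues start at 0. The two ranges differ by
-- exchanging n for 0, and each of these is coprime to n exactly when the other is.
φ≡Σ : ∀ n → φ n ≡ Σ n (λ k → 𝟙 (coprime? k n))
φ≡Σ n = begin
  length (filter (λ k → coprime? k n) (map suc (upTo n)))
    ≡⟨ cong (length ∘ filter (λ k → coprime? k n)) (map-applyUpTo id suc n) ⟩
  length (filter (λ k → coprime? k n) (applyUpTo suc n))
    ≡⟨ length-filter-applyUpTo (λ k → coprime? k n) suc n ⟩
  Σ n (λ k → 𝟙 (coprime? (suc k) n))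
    ≡⟨ Σ-shift n (λ k → 𝟙 (coprime? k n)) (𝟙-cong coprime-n⇔coprime-0 (coprime? n n) (coprime? 0 n)) ⟩
  Σ n (λ k → 𝟙 (coprime? k n))
    ∎
  where
  coprime-n⇔coprime-0 : Coprime n n ⇔ Coprime 0 n
  coprime-n⇔coprime-0 = mk⇔
    (λ c {_} (_ , d∣n) → c (d∣n , d∣n))
    (λ c {_} (_ , d∣n) → c (_ ℕ.∣0 , d∣n))

-- Inverses and linear congruences.

∣i-j∣i⇒∣j : ∀ {k i j} → k ∣ i ℤ.- j → k ∣ i → k ∣ j
∣i-j∣i⇒∣j {k} {i} {j} k∣i-j k∣i = subst (k ∣_) (cancel i j) (ℤ.∣m∣n⇒∣m-n k∣i k∣i-j)
  where
  cancel : ∀ i j → i ℤ.- (i ℤ.- j) ≡ j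
  cancel = solve-∀

-- Over ℕ, Bézout's identity reads 1 + y n = x m or 1 + x m = y n, and the inverse of m is x or - x
-- accordingly. A negative u takes the negated inverse of `∣ u ∣`.
inverse-mod : ∀ u n → Coprime ∣ u ∣ n → ∃[ w ] + n ∣ u ℤ.* w ℤ.- + 1
inverse-mod u n c = lift u (pos-inverse (coprime-Bézout c))
  where
  pos-inverse : ∀ {m} → Bézout.Identity 1 m n → ∃[ w ] + n ∣ + m ℤ.* w ℤ.- + 1
  pos-inverse {m} (Bézout.+- x y eq) = + x , divides (+ y) (begin
    + m ℤ.* + x ℤ.- + 1           ≡⟨ cong (ℤ._- + 1) (ℤ.*-comm (+ m) (+ x)) ⟩
    + x ℤ.* + m ℤ.- + 1           ≡⟨ cong (ℤ._- + 1) (ℤ.pos-* x m) ⟨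
    + (x * m) ℤ.- + 1             ≡⟨ cong (λ z → + z ℤ.- + 1) eq ⟨
    + (1 + y * n) ℤ.- + 1         ≡⟨ cong (ℤ._- + 1) (pos-affine 1 y n) ⟩
    + 1 ℤ.+ + y ℤ.* + n ℤ.- + 1   ≡⟨ cancel (+ y) (+ n) ⟩
    + y ℤ.* + n                   ∎)
    where
    cancel : ∀ y n → + 1 ℤ.+ y ℤ.* n ℤ.- + 1 ≡ y ℤ.* n
    cancel = solve-∀
  pos-inverse {m} (Bézout.-+ x y eq) = ℤ.- + x , divides (ℤ.- + y) (begin
    + m ℤ.* (ℤ.- + x) ℤ.- + 1     ≡⟨ negate (+ m) (+ x) ⟩
    ℤ.- (+ 1 ℤ.+ + x ℤ.* + m)     ≡⟨ cong ℤ.-_ (pos-affine 1 x m) ⟨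
    ℤ.- + (1 + x * m)             ≡⟨ cong (λ z → ℤ.- + z) eq ⟩
    ℤ.- + (y * n)                 ≡⟨ cong ℤ.-_ (ℤ.pos-* y n) ⟩
    ℤ.- (+ y ℤ.* + n)             ≡⟨ ℤ.neg-distribˡ-* (+ y) (+ n) ⟩
    ℤ.- + y ℤ.* + n               ∎)
    where
    negate : ∀ m x → m ℤ.* (ℤ.- x) ℤ.- + 1 ≡ ℤ.- (+ 1 ℤ.+ x ℤ.* m)
    negate = solve-∀

  lift : ∀ u → ∃[ w ] + n ∣ + ∣ u ∣ ℤ.* w ℤ.- + 1 → ∃[ w ] + n ∣ u ℤ.* w ℤ.- + 1
  lift (+ _)      inv     = inv
  lift u@(-[1+ k ]) (w , n∣) = ℤ.- w , subst (λ i → + n ∣ i ℤ.- + 1) (neg-neg (+ suc k) w) n∣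
    where
    neg-neg : ∀ u w → u ℤ.* w ≡ (ℤ.- u) ℤ.* (ℤ.- w)
    neg-neg = solve-∀

-- With w an inverse of u, the solutions are the y ≡ w v, and c is the remainder of w v. The
-- identities `to-eq` and `from-eq` write y - c and u y - v as combinations of multiples of n.
linear-congruence : ∀ u n .{{_ : NonZero n}} → Coprime ∣ u ∣ n → ∀ v →
                    ∃[ c ] c < n × (∀ y → (+ n ∣ u ℤ.* y ℤ.- v) ⇔ (+ n ∣ y ℤ.- + c))
linear-congruence u n u⊥n v with w , n∣uw-1 ← inverse-mod u n u⊥n = c , n%ℕd<d (w ℤ.* v) n , λ y → mk⇔
  (λ n∣uy-v → subst (+ n ∣_) (to-eq u w v y (+ c))
    (ℤ.∣m∣n⇒∣m+n
      (ℤ.∣m∣n⇒∣m-n (ℤ.∣n⇒∣m*n w n∣uy-v) (ℤ.∣n⇒∣m*n y n∣uw-1)) n∣wv-c))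
  (λ n∣y-c → subst (+ n ∣_) (from-eq u w v y (+ c))
    (ℤ.∣m∣n⇒∣m+n (ℤ.∣n⇒∣m*n u (ℤ.∣m∣n⇒∣m-n n∣y-c n∣wv-c)) (ℤ.∣n⇒∣m*n v n∣uw-1)))
  where
  c = (w ℤ.* v) %ℕ n

  n∣wv-c : + n ∣ w ℤ.* v ℤ.- + c
  n∣wv-c = divides ((w ℤ.* v) /ℕ n)
    (trans (cong (ℤ._- + c) (a≡a%ℕn+[a/ℕn]*n (w ℤ.* v) n)) (cancel (+ c) _))
    where
    cancel : ∀ c x → c ℤ.+ x ℤ.- c ≡ x
    cancel = solve-∀

  to-eq : ∀ u w v y c →
    w ℤ.* (u ℤ.* y ℤ.- v) ℤ.- y ℤ.* (u ℤ.* w ℤ.- + 1) ℤ.+ (w ℤ.* v ℤ.- c) ≡ y ℤ.- c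
  to-eq = solve-∀

  from-eq : ∀ u w v y c →
    u ℤ.* ((y ℤ.- c) ℤ.- (w ℤ.* v ℤ.- c)) ℤ.+ v ℤ.* (u ℤ.* w ℤ.- + 1) ≡ u ℤ.* y ℤ.- v
  from-eq = solve-∀

-- Natural numbers and their quotients in ℚ.

ι : ℕ → ℚ
ι n = + n ℚ./ 1

-- A quotient in ℚ is by definition a value of `fromℚᵘ`. Once this map respects the operations,
-- identities between quotients become cross multiplications in ℤ.
fromℚᵘ-homo-+ : ∀ p q → ℚ.fromℚᵘ (p ℚᵘ.+ q) ≡ ℚ.fromℚᵘ p ℚ.+ ℚ.fromℚᵘ q
fromℚᵘ-homo-+ p q = ℚ.toℚᵘ-injective (ℚᵘ.≃-trans (ℚ.toℚᵘ-fromℚᵘ (p ℚᵘ.+ q)) (ℚᵘ.≃-sym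
  (ℚᵘ.≃-trans (ℚ.toℚᵘ-homo-+ (ℚ.fromℚᵘ p) (ℚ.fromℚᵘ q))
              (ℚᵘ.+-cong (ℚ.toℚᵘ-fromℚᵘ p) (ℚ.toℚᵘ-fromℚᵘ q)))))

fromℚᵘ-homo-* : ∀ p q → ℚ.fromℚᵘ (p ℚᵘ.* q) ≡ ℚ.fromℚᵘ p ℚ.* ℚ.fromℚᵘ q
fromℚᵘ-homo-* p q = ℚ.toℚᵘ-injective (ℚᵘ.≃-trans (ℚ.toℚᵘ-fromℚᵘ (p ℚᵘ.* q)) (ℚᵘ.≃-sym
  (ℚᵘ.≃-trans (ℚ.toℚᵘ-homo-* (ℚ.fromℚᵘ p) (ℚ.fromℚᵘ q))
              (ℚᵘ.*-cong (ℚ.toℚᵘ-fromℚᵘ p) (ℚ.toℚᵘ-fromℚᵘ q)))))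

ι-+ : ∀ m n → ι (m + n) ≡ ι m ℚ.+ ι n
ι-+ m n = trans
  (ℚ.fromℚᵘ-cong {mkℚᵘ (+ (m + n)) 0} {mkℚᵘ (+ m) 0 ℚᵘ.+ mkℚᵘ (+ n) 0} (*≡* (begin
    + (m + n) ℤ.* + 1                       ≡⟨ cong (ℤ._* + 1) (ℤ.pos-+ m n) ⟩
    (+ m ℤ.+ + n) ℤ.* + 1                   ≡⟨ lemma (+ m) (+ n) ⟩
    (+ m ℤ.* + 1 ℤ.+ + n ℤ.* + 1) ℤ.* + 1   ∎)))
  (fromℚᵘ-homo-+ (mkℚᵘ (+ m) 0) (mkℚᵘ (+ n) 0))
  where
  lemma : ∀ m n → (m ℤ.+ n) ℤ.* + 1 ≡ (m ℤ.* + 1 ℤ.+ n ℤ.* + 1) ℤ.* + 1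
  lemma = solve-∀

ι-* : ∀ m n → ι (m * n) ≡ ι m ℚ.* ι n
ι-* m n = trans
  (ℚ.fromℚᵘ-cong {mkℚᵘ (+ (m * n)) 0} {mkℚᵘ (+ m) 0 ℚᵘ.* mkℚᵘ (+ n) 0}
    (*≡* (cong (ℤ._* + 1) (ℤ.pos-* m n))))
  (fromℚᵘ-homo-* (mkℚᵘ (+ m) 0) (mkℚᵘ (+ n) 0))

ι-*-1/ : ∀ k → ι (suc k) ℚ.* (+ 1 ℚ./ suc k) ≡ 1ℚ
ι-*-1/ k = trans
  (sym (fromℚᵘ-homo-* (mkℚᵘ (+ suc k) 0) (mkℚᵘ (+ 1) k)))
  (ℚ.fromℚᵘ-cong {mkℚᵘ (+ suc k) 0 ℚᵘ.* mkℚᵘ (+ 1) k} {mkℚᵘ (+ 1) 0}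
    (*≡* (lemma (+ suc k))))
  where
  lemma : ∀ m → m ℤ.* + 1 ℤ.* + 1 ≡ + 1 ℤ.* (+ 1 ℤ.* m)
  lemma = solve-∀

ι-injective : ∀ {m n} → ι m ≡ ι n → m ≡ n
ι-injective {m} {n} eq with ℚ.fromℚᵘ-injective {mkℚᵘ (+ m) 0} {mkℚᵘ (+ n) 0} eq
... | *≡* eq′ = ℤ.+-injective (ℤ.*-cancelʳ-≡ (+ m) (+ n) (+ 1) eq′)

-- Turns φ(m) = φ(e) N, proved in ℕ, into the value N of the quotient φ(m)/φ(e).
/-≡ι : ∀ {m n o} .{{_ : NonZero n}} → m ≡ n * o → + m ℚ./ n ≡ ι o
/-≡ι {n = n@(suc n-1)} {o} refl = ℚ.fromℚᵘ-cong {mkℚᵘ (+ (n * o)) n-1} {mkℚᵘ (+ o) 0}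
  (*≡* (trans (cong (ℤ._* + 1) (ℤ.pos-* n o)) (lemma (+ n) (+ o))))
  where
  lemma : ∀ n o → n ℤ.* o ℤ.* + 1 ≡ o ℤ.* n
  lemma = solve-∀

-- Sieving an arithmetic progression by distinct primes.

-- A prime p is listed by its predecessor, as in `∏[1-1/p]`, so that 1/p is visibly defined.
free? : ∀ ks x → Dec (All (λ k → suc k ∤ x) ks)
free? ks x = All.all? (λ k → ¬? (suc k ℕ.∣? x)) ks

distinct-prime-∤ : ∀ {p q} → Prime p → Prime q → p ≢ q → p ∤ q
distinct-prime-∤ p-prime q-prime p≢q p∣q with prime⇒irreducible q-prime p∣q
... | inj₁ refl = ¬prime[1] p-prime
... | inj₂ p≡q  = p≢q p≡q

prime∤⇒coprime : ∀ {p n} → Prime p → p ∤ n → Coprime n p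
prime∤⇒coprime p-prime p∤n (d∣n , d∣p) with prime⇒irreducible p-prime d∣p
... | inj₁ d≡1  = d≡1
... | inj₂ refl = contradiction d∣n p∤n

∏[1-1/1+_] : List ℕ → ℚ
∏[1-1/1+ ks ] = ∏ℚ (map (λ k → 1ℚ ℚ.- (+ 1 ℚ./ suc k)) ks)

-- With p = `suc k`, `T` counts the candidates left by the other primes, `B` those of them divisible
-- by p, and `S` the rest. Then S = m p P - m P, and m = m p (1/p).
sieve-step : ∀ m k P S B T → S + B ≡ T → ι T ≡ ι (m * suc k) ℚ.* P → ι B ≡ ι m ℚ.* P →
             ι S ≡ ι (m * suc k) ℚ.* ((1ℚ ℚ.- (+ 1 ℚ./ suc k)) ℚ.* P)
sieve-step m k P S B T S+B≡T ιT ιB = begin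
  ι S                                ≡⟨ S≡S+B-B (ι S) (ι B) ⟩
  ι S ℚ.+ ι B ℚ.- ι B                ≡⟨ cong (ℚ._- ι B) (trans (sym (ι-+ S B)) (trans (cong ι S+B≡T) ιT)) ⟩
  ι (m * suc k) ℚ.* P ℚ.- ι B        ≡⟨ cong₂ (λ x y → x ℚ.* P ℚ.- y) (ι-* m (suc k)) ιB ⟩
  ι m ℚ.* ι (suc k) ℚ.* P ℚ.- ι m ℚ.* P
    ≡⟨ factor (ι m) (ι (suc k)) (+ 1 ℚ./ suc k) P (ι-*-1/ k) ⟩
  ι m ℚ.* ι (suc k) ℚ.* ((1ℚ ℚ.- (+ 1 ℚ./ suc k)) ℚ.* P)
    ≡⟨ cong (ℚ._* ((1ℚ ℚ.- (+ 1 ℚ./ suc k)) ℚ.* P)) (ι-* m (suc k)) ⟨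
  ι (m * suc k) ℚ.* ((1ℚ ℚ.- (+ 1 ℚ./ suc k)) ℚ.* P) ∎
  where
  open +-*-Solver using (solve; _:+_; _:*_; _:-_; _:=_; con)

  S≡S+B-B : ∀ s b → s ≡ s ℚ.+ b ℚ.- b
  S≡S+B-B = solve 2 (λ s b → s := s :+ b :- b) refl

  factor : ∀ m p r P → p ℚ.* r ≡ 1ℚ → m ℚ.* p ℚ.* P ℚ.- m ℚ.* P ≡ m ℚ.* p ℚ.* ((1ℚ ℚ.- r) ℚ.* P)
  factor m p r P pr≡1 = begin
    m ℚ.* p ℚ.* P ℚ.- m ℚ.* P
      -- The factor p r = 1 is inserted into the subtracted term, which leaves a polynomial identity
      -- for the solver.
      ≡⟨ cong (λ x → m ℚ.* p ℚ.* P ℚ.- m ℚ.* x) (trans (cong (ℚ._* P) pr≡1) (ℚ.*-identityˡ P)) ⟨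
    m ℚ.* p ℚ.* P ℚ.- m ℚ.* (p ℚ.* r ℚ.* P)
      ≡⟨ solve 4 (λ m p r P → m :* p :* P :- m :* (p :* r :* P) := m :* p :* ((con 1ℚ :- r) :* P)) refl m p r P ⟩
    m ℚ.* p ℚ.* ((1ℚ ℚ.- r) ℚ.* P)
      ∎

-- Since e is invertible modulo p, p divides c + e i exactly when i lies in one residue class i₀
-- modulo p. Putting i = i₀ + p j gives a progression of step e p starting at c + e i₀, whatever `m`
-- and `Q` are.
Σ-multiples : ∀ {e p} .{{_ : NonZero p}} → Coprime e p → ∀ c →
              ∃[ c′ ] (∀ m {Q : Pred ℕ 0ℓ} (Q? : Decidable Q) →
                Σ (m * p) (λ i → 𝟙 ((p ℕ.∣? (c + e * i)) ×-dec Q? (c + e * i)))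
                ≡ Σ m (λ j → 𝟙 (Q? (c′ + e * p * j))))
Σ-multiples {e} {p} e⊥p c
  = c + e * i₀ , λ m Q? → begin
    Σ (m * p) (λ i → 𝟙 ((p ℕ.∣? (c + e * i)) ×-dec Q? (c + e * i)))
      ≡⟨ Σ-residue m _ i₀<p (λ i p∤ → 𝟙-false ((p ℕ.∣? (c + e * i)) ×-dec Q? (c + e * i))
                                               (p∤ ∘ to (p∣⇔ i) ∘ proj₁)) ⟩
    Σ m (λ j → 𝟙 ((p ℕ.∣? (c + e * (i₀ + p * j))) ×-dec Q? (c + e * (i₀ + p * j))))
      ≡⟨ Σ-cong m (λ {j} _ → 𝟙-cong
           (mk⇔ proj₂ (from (p∣⇔ (i₀ + p * j)) (progression-∣ i₀ p j) ,_))
           ((p ℕ.∣? (c + e * (i₀ + p * j))) ×-dec Q? (c + e * (i₀ + p * j)))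
           (Q? (c + e * (i₀ + p * j)))) ⟩
    Σ m (λ j → 𝟙 (Q? (c + e * (i₀ + p * j))))
      ≡⟨ Σ-cong m (λ {j} _ → cong (λ x → 𝟙 (Q? x)) (regroup j)) ⟩
    Σ m (λ j → 𝟙 (Q? (c + e * i₀ + e * p * j)))
      ∎
  where
  solved : ∃[ i₀ ] i₀ < p × (∀ y → (+ p ∣ + e ℤ.* y ℤ.- (ℤ.- + c)) ⇔ (+ p ∣ y ℤ.- + i₀))
  solved = linear-congruence (+ e) p e⊥p (ℤ.- + c)

  i₀ : ℕ
  i₀ = proj₁ solved

  i₀<p : i₀ < p
  i₀<p = proj₁ (proj₂ solved)

  p∣⇔ : ∀ i → p ℕ.∣ c + e * i ⇔ + p ∣ + i ℤ.- + i₀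
  p∣⇔ i = mk⇔
    (λ p∣x → to i-solves⇔ (subst (+ p ∣_) affine (∣ᵤ⇒∣ p∣x)))
    (λ p∣i-i₀ → ∣⇒∣ᵤ (subst (+ p ∣_) (sym affine) (from i-solves⇔ p∣i-i₀)))
    where
    i-solves⇔ : (+ p ∣ + e ℤ.* + i ℤ.- (ℤ.- + c)) ⇔ (+ p ∣ + i ℤ.- + i₀)
    i-solves⇔ = proj₂ (proj₂ solved) (+ i)

    lemma : ∀ c e i → c ℤ.+ e ℤ.* i ≡ e ℤ.* i ℤ.- (ℤ.- c)
    lemma = solve-∀
    affine : + (c + e * i) ≡ + e ℤ.* + i ℤ.- (ℤ.- + c)
    affine = trans (pos-affine c e i) (lemma (+ c) (+ e) (+ i))

  regroup : ∀ j → c + e * (i₀ + p * j) ≡ c + e * i₀ + e * p * j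
  regroup j = begin
    c + e * (i₀ + p * j)          ≡⟨ cong (c ℕ.+_) (ℕ.*-distribˡ-+ e i₀ (p * j)) ⟩
    c + (e * i₀ + e * (p * j))    ≡⟨ ℕ.+-assoc c (e * i₀) _ ⟨
    c + e * i₀ + e * (p * j)      ≡⟨ cong (c + e * i₀ ℕ.+_) (ℕ.*-assoc e p j) ⟨
    c + e * i₀ + e * p * j        ∎

-- Among the x = c + e * i, those divisible by the first prime p again form
-- a progression, of length n / p and step e * p.
sieve : ∀ ks → Unique ks → ∀ n e →
        All (λ k → Prime (suc k) × suc k ℕ.∣ n × suc k ∤ e) ks → ∀ c →
        ι (Σ n (λ i → 𝟙 (free? ks (c + e * i)))) ≡ ι n ℚ.* ∏[1-1/1+ ks ]
sieve [] [] n e [] c = trans (cong ι (Σ-one n)) (sym (ℚ.*-identityʳ (ι n)))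
  where
  Σ-one : ∀ n → Σ n (λ _ → 1) ≡ n
  Σ-one zero    = refl
  Σ-one (suc n) = cong suc (Σ-one n)
sieve (k ∷ ks) (k∉ks ∷ ks!) _ e ((p-prime , ℕ.divides m refl , p∤e) ∷ hyps) c
  = let c′ , multiples = Σ-multiples (prime∤⇒coprime p-prime p∤e) c in
    sieve-step m k ∏[1-1/1+ ks ] S B T
      (trans (sym (Σ-+ (m * suc k) _ _)) (Σ-cong (m * suc k) (λ {i} _ → split (x i))))
      -- The induction hypothesis is needed twice, for the whole progression here and for its
      -- multiples of p next. The second use has another length, step and start, so all three must
      -- be general.
      (sieve ks ks! (m * suc k) e hyps c)
      (trans (cong ι (multiples m (free? ks))) (sieve ks ks! m (e * suc k) hyps′ c′))
  where
  x : ℕ → ℕ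
  x i = c + e * i

  S = Σ (m * suc k) (λ i → 𝟙 (free? (k ∷ ks) (x i)))
  T = Σ (m * suc k) (λ i → 𝟙 (free? ks (x i)))
  B = Σ (m * suc k) (λ i → 𝟙 ((suc k ℕ.∣? x i) ×-dec free? ks (x i)))

  split : ∀ y → 𝟙 (free? (k ∷ ks) y) + 𝟙 ((suc k ℕ.∣? y) ×-dec free? ks y) ≡ 𝟙 (free? ks y)
  split y = trans
    (cong (_+ 𝟙 ((suc k ℕ.∣? y) ×-dec free? ks y)) (𝟙-cong (mk⇔ All.uncons (λ (q , qs) → q ∷ qs))
      (free? (k ∷ ks) y) (¬? (suc k ℕ.∣? y) ×-dec free? ks y)))
    (𝟙-¬×+𝟙-× (suc k ℕ.∣? y) (free? ks y))

  -- A later prime q differs from p. It therefore still divides n / p = m, and still does not divide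
  -- e p.
  hyps′ : All (λ l → Prime (suc l) × suc l ℕ.∣ m × suc l ∤ e * suc k) ks
  hyps′ = All.zipWith step (k∉ks , hyps)
    where
    step : ∀ {l} → k ≢ l × (Prime (suc l) × suc l ℕ.∣ m * suc k × suc l ∤ e) →
           Prime (suc l) × suc l ℕ.∣ m × suc l ∤ e * suc k
    step {l} (k≢l , q-prime , q∣mp , q∤e) = q-prime , q∣m , q∤ep
      where
      q∤p : suc l ∤ suc k
      q∤p = distinct-prime-∤ q-prime p-prime (k≢l ∘ sym ∘ ℕ.suc-injective)

      q∣m : suc l ℕ.∣ m
      q∣m with euclidsLemma m (suc k) q-prime q∣mp
      ... | inj₁ q∣m = q∣m
      ... | inj₂ q∣p = contradiction q∣p q∤p

      q∤ep : suc l ∤ e * suc k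
      q∤ep q∣ep with euclidsLemma e (suc k) q-prime q∣ep
      ... | inj₁ q∣e = q∤e q∣e
      ... | inj₂ q∣p = q∤p q∣p

-- Coprimality to d e within a residue class modulo e, and the totient.

sieving-prime? : ∀ d e k → Dec (Prime (suc k) × suc k ℕ.∣ d × suc k ∤ e)
sieving-prime? d e k = prime? (suc k) ×-dec (suc k ℕ.∣? d) ×-dec ¬? (suc k ℕ.∣? e)

-- The index list of `∏[1-1/p] d e`, so the product delivered by `sieve` is this one by definition.
sieving-primes : (d e : ℕ) → List ℕ
sieving-primes d e = filter (sieving-prime? d e) (upTo d)

-- A common divisor is nonzero because n is. The head of its prime factorisation would be a common
-- prime, so the factorisation is empty.
no-common-prime⇒coprime : ∀ {m n} .{{_ : NonZero n}} →
                          (∀ {p} → Prime p → p ℕ.∣ m → p ∤ n) → Coprime m n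
no-common-prime⇒coprime {m} {n} no-common {g} (g∣m , g∣n) =
  g≡1 (factorise g {{ℕ.≢-nonZero λ g≡0 → ℕ.≢-nonZero⁻¹ n (ℕ.0∣⇒≡0 (subst (ℕ._∣ n) g≡0 g∣n))}})
  where
  g≡1 : PrimeFactorisation g → g ≡ 1
  g≡1 record { factors = [] ; isFactorisation = g≡1 } = g≡1
  g≡1 record { factors = p ∷ ps ; isFactorisation = g≡p*ps ; factorsPrime = p-prime ∷ _ } =
    contradiction (ℕ.∣-trans p∣g g∣n) (no-common p-prime (ℕ.∣-trans p∣g g∣m))
    where
    p∣g : p ℕ.∣ g
    p∣g = subst (p ℕ.∣_) (sym g≡p*ps) (ℕ.m∣m*n _)

-- A prime dividing x and d e does not divide e, as x is coprime to e. So it divides d, and being at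
-- most d it occurs in the list.
coprime⇔free : ∀ {d e} .{{_ : NonZero d}} .{{_ : NonZero e}} x → Coprime x e →
               Coprime x (d * e) ⇔ All (λ k → suc k ∤ x) (sieving-primes d e)
coprime⇔free {d} {e} x x⊥e = mk⇔
  (λ (x⊥de : Coprime x (d * e)) → All.tabulate (free x⊥de))
  (λ free → no-common-prime⇒coprime {{ℕ.m*n≢0 d e}} (no-common free))
  where
  free : Coprime x (d * e) → ∀ {k} → k ∈ sieving-primes d e → suc k ∤ x
  free x⊥de k∈ p∣x =
    let (_ , p-prime , p∣d , _) = ∈-filter⁻ (sieving-prime? d e) {xs = upTo d} k∈
    in ¬prime[1] (subst Prime (x⊥de (p∣x , ℕ.∣m⇒∣m*n e p∣d)) p-prime)

  no-common : All (λ k → suc k ∤ x) (sieving-primes d e) →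
              ∀ {p} → Prime p → p ℕ.∣ x → p ∤ d * e
  no-common free {zero}  p-prime p∣x p∣de = ¬prime[0] p-prime
  no-common free {suc k} p-prime p∣x p∣de = All.lookup free
    (∈-filter⁺ (sieving-prime? d e) (∈-upTo⁺ (ℕ.∣⇒≤ p∣d)) (p-prime , p∣d , p∤e)) p∣x
    where
    p∤e : suc k ∤ e
    p∤e p∣e = ¬prime[1] (subst Prime (x⊥e (p∣x , p∣e)) p-prime)

    p∣d : suc k ℕ.∣ d
    p∣d with euclidsLemma d e p-prime p∣de
    ... | inj₁ p∣d = p∣d
    ... | inj₂ p∣e = contradiction p∣e p∤e

coprime-+* : ∀ {c e} k → Coprime c e → Coprime (c + e * k) e
coprime-+* {c} {e} k c⊥e {g} (g∣c+ek , g∣e) =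
  c⊥e (ℕ.∣m+n∣m⇒∣n (subst (g ℕ.∣_) (ℕ.+-comm c (e * k)) g∣c+ek) (ℕ.∣m⇒∣m*n k g∣e) , g∣e)

-- Every c + e k inherits coprimality to e from c, so only the sieving primes remain to be avoided.
-- The right side is independent of `c`, which is the point for `φ-*`.
count-coprime : ∀ d e .{{_ : NonZero d}} .{{_ : NonZero e}} {c} → Coprime c e →
                ι (Σ d (λ k → 𝟙 (coprime? (c + e * k) (d * e)))) ≡ ι d ℚ.* ∏[1-1/p] d e
count-coprime d e {c} c⊥e = trans
  (cong ι (Σ-cong d (λ {k} _ → 𝟙-cong (coprime⇔free (c + e * k) (coprime-+* k c⊥e))
    (coprime? (c + e * k) (d * e)) (free? (sieving-primes d e) (c + e * k)))))
  (sieve (sieving-primes d e) (filter⁺ (sieving-prime? d e) (upTo⁺ d)) d e (all-filter (sieving-prime? d e) (upTo d)) c)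

-- The residues modulo d e are grouped by their residue s modulo e. For s coprime to e, the group
-- contributes as much as that of c, by `count-coprime`; otherwise a common factor of s and e
-- persists and it contributes nothing.
φ-* : ∀ d e .{{_ : NonZero d}} .{{_ : NonZero e}} {c} → Coprime c e →
      φ (d * e) ≡ φ e * Σ d (λ k → 𝟙 (coprime? (c + e * k) (d * e)))
φ-* d e {c} c⊥e = begin
  φ (d * e)                                        ≡⟨ φ≡Σ (d * e) ⟩
  Σ (d * e) (λ x → 𝟙 (coprime? x (d * e)))         ≡⟨ Σ-* d e _ ⟩
  Σ e (λ s → Σ d (λ k → 𝟙 (coprime? (s + e * k) (d * e))))
    ≡⟨ Σ-cong e (λ {s} _ → per-residue s (coprime? s e)) ⟩
  Σ e (λ s → 𝟙 (coprime? s e) * N)                 ≡⟨ Σ-*ʳ e _ N ⟩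
  Σ e (λ s → 𝟙 (coprime? s e)) * N                 ≡⟨ cong (_* N) (φ≡Σ e) ⟨
  φ e * N                                          ∎
  where
  N : ℕ
  N = Σ d (λ k → 𝟙 (coprime? (c + e * k) (d * e)))

  per-residue : ∀ s (s⊥e? : Dec (Coprime s e)) →
                Σ d (λ k → 𝟙 (coprime? (s + e * k) (d * e))) ≡ 𝟙 s⊥e? * N
  per-residue s (yes s⊥e) = trans
    (ι-injective (trans (count-coprime d e s⊥e) (sym (count-coprime d e c⊥e))))
    (sym (ℕ.+-identityʳ N))
  per-residue s (no ¬s⊥e) = Σ-zero d (λ {k} _ → 𝟙-false (coprime? (s + e * k) (d * e))
    (λ s+ek⊥de → ¬s⊥e (λ (g∣s , g∣e) →
      s+ek⊥de (ℕ.∣m∣n⇒∣m+n g∣s (ℕ.∣m⇒∣m*n k g∣e) , ℕ.∣n⇒∣m*n d g∣e))))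

-- Dividing the congruence by t and by d.

gcd≡⇔coprime : ∀ k m t .{{_ : NonZero t}} → ℕ.gcd (k * t) (m * t) ≡ t ⇔ Coprime k m
gcd≡⇔coprime k m t = mk⇔ gcd≡⇒coprime coprime⇒gcd≡
  where
  scaled : t * ℕ.gcd k m ≡ ℕ.gcd (k * t) (m * t)
  scaled = trans (ℕ.c*gcd[m,n]≡gcd[cm,cn] t k m) (cong₂ ℕ.gcd (ℕ.*-comm t k) (ℕ.*-comm t m))

  gcd≡⇒coprime : ℕ.gcd (k * t) (m * t) ≡ t → Coprime k m
  gcd≡⇒coprime eq = Coprime.gcd≡1⇒coprime (ℕ.*-cancelˡ-≡ (ℕ.gcd k m) 1 t
    (trans scaled (trans eq (sym (ℕ.*-identityʳ t)))))

  coprime⇒gcd≡ : Coprime k m → ℕ.gcd (k * t) (m * t) ≡ t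
  coprime⇒gcd≡ k⊥m = trans (sym scaled)
    (trans (cong (t *_) (Coprime.coprime⇒gcd≡1 k⊥m)) (ℕ.*-identityʳ t))

∣-scale : ∀ {m i j} t .{{_ : NonZero t}} → j ≡ i ℤ.* + t → (+ (m * t) ∣ j) ⇔ (+ m ∣ i)
∣-scale {m} {i} t refl = mk⇔
  (λ mt∣ → ℤ.*-cancelʳ-∣ (+ t) (subst (_∣ i ℤ.* + t) (ℤ.pos-* m t) mt∣))
  (λ m∣i → subst (_∣ i ℤ.* + t) (sym (ℤ.pos-* m t)) (ℤ.*-monoˡ-∣ (+ t) m∣i))

-- Both the congruence and the gcd condition are divided by t. Here `b` and `m` stand for b/t and
-- n/t of the theorem.
isSolution-scale : ∀ a b m t .{{_ : NonZero t}} y →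
  IsSolution a (b ℤ.* + t) (m * t) t (y ℤ.* + t) ⇔ ((+ m ∣ a ℤ.* y ℤ.- b) × Coprime ∣ y ∣ m)
isSolution-scale a b m t y = mk⇔ scale-down scale-up
  where
  congruence : (+ (m * t) ∣ a ℤ.* (y ℤ.* + t) ℤ.- b ℤ.* + t) ⇔ (+ m ∣ a ℤ.* y ℤ.- b)
  congruence = ∣-scale t (lemma a b y (+ t))
    where
    lemma : ∀ a b y t → a ℤ.* (y ℤ.* t) ℤ.- b ℤ.* t ≡ (a ℤ.* y ℤ.- b) ℤ.* t
    lemma = solve-∀

  gcd-abs : ℕ.gcd ∣ y ℤ.* + t ∣ (m * t) ≡ ℕ.gcd (∣ y ∣ * t) (m * t)
  gcd-abs = cong (λ k → ℕ.gcd k (m * t)) (ℤ.abs-* y (+ t))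

  scale-down : IsSolution a (b ℤ.* + t) (m * t) t (y ℤ.* + t) →
               (+ m ∣ a ℤ.* y ℤ.- b) × Coprime ∣ y ∣ m
  scale-down (mt∣ , gcd≡t) = to congruence mt∣ ,
    to (gcd≡⇔coprime ∣ y ∣ m t) (trans (sym gcd-abs) (ℤ.+-injective gcd≡t))

  scale-up : (+ m ∣ a ℤ.* y ℤ.- b) × Coprime ∣ y ∣ m →
             IsSolution a (b ℤ.* + t) (m * t) t (y ℤ.* + t)
  scale-up (m∣ , y⊥m) = from congruence m∣ ,
    cong +_ (trans gcd-abs (from (gcd≡⇔coprime ∣ y ∣ m t) y⊥m))

-- Every x with (x , n) = t lies in the class 0 modulo t, so only the x = t k with k < m can
-- contribute.
#solutions-scale : ∀ a b m t .{{_ : NonZero t}} →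
  #solutions a (b ℤ.* + t) (m * t) t ≡
  Σ m (λ k → 𝟙 ((+ m ℤ.∣? a ℤ.* + k ℤ.- b) ×-dec coprime? k m))
#solutions-scale a b m t = begin
  #solutions a (b ℤ.* + t) (m * t) t
    ≡⟨ length-filter-tabulate (sol? ∘ toℕ) {m * t} id (𝟙 ∘ sol?) (λ _ → refl) ⟩
  Σ (m * t) (𝟙 ∘ sol?)
    ≡⟨ Σ-residue m (𝟙 ∘ sol?) (ℕ.>-nonZero⁻¹ t) (λ x t∤x → 𝟙-false (sol? x) (t∤x ∘ t∣x x)) ⟩
  Σ m (λ k → 𝟙 (sol? (t * k)))
    ≡⟨ Σ-cong m (λ {k} _ → 𝟙-cong
         (subst (λ x → Sol x ⇔ _) (sym (trans (ℤ.pos-* t k) (ℤ.*-comm (+ t) (+ k)))) (isSolution-scale a b m t (+ k)))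
         (sol? (t * k)) ((+ m ℤ.∣? a ℤ.* + k ℤ.- b) ×-dec coprime? k m)) ⟩
  Σ m (λ k → 𝟙 ((+ m ℤ.∣? a ℤ.* + k ℤ.- b) ×-dec coprime? k m))
    ∎
  where
  Sol : ℤ → Set
  Sol = IsSolution a (b ℤ.* + t) (m * t) t

  sol? : ∀ x → Dec (Sol (+ x))
  sol? x = isSolution? a (b ℤ.* + t) (m * t) t (+ x)

  t∣x : ∀ x → Sol (+ x) → + t ∣ + x ℤ.- + 0
  t∣x x (_ , gcd≡t) = subst (+ t ∣_) (sym (ℤ.+-identityʳ (+ x)))
    (∣ᵤ⇒∣ (subst (ℕ._∣ x) (ℤ.+-injective gcd≡t) (ℕ.gcd[m,n]∣m x (m * t))))

-- Here `a` and `b` are the cofactors left after dividing by d, so `a` is invertible modulo e. The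
-- congruence then selects one class c modulo e, and inside it only coprimality to d e is left to
-- test.
#solutions-residue : ∀ a b d e t .{{_ : NonZero d}} .{{_ : NonZero e}} .{{_ : NonZero t}} →
  Coprime ∣ a ∣ e → Coprime ∣ b ∣ e →
  ∃[ c ] Coprime c e ×
    #solutions (a ℤ.* + d) (b ℤ.* + d ℤ.* + t) (d * e * t) t ≡
    Σ d (λ k → 𝟙 (coprime? (c + e * k) (d * e)))
#solutions-residue a b d e t a⊥e b⊥e = c , c⊥e , (begin
  #solutions (a ℤ.* + d) (b ℤ.* + d ℤ.* + t) (d * e * t) t
    ≡⟨ #solutions-scale (a ℤ.* + d) (b ℤ.* + d) (d * e) t ⟩
  Σ (d * e) (𝟙 ∘ sol?)
    ≡⟨ Σ-residue d (𝟙 ∘ sol?) c<e (λ x e∤ → 𝟙-false (sol? x) (e∤ ∘ to (congruence x) ∘ proj₁)) ⟩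
  Σ d (λ k → 𝟙 (sol? (c + e * k)))
    ≡⟨ Σ-cong d (λ {k} _ → 𝟙-cong (mk⇔ proj₂ (from (congruence (c + e * k)) (progression-∣ c e k) ,_))
         (sol? (c + e * k)) (coprime? (c + e * k) (d * e))) ⟩
  Σ d (λ k → 𝟙 (coprime? (c + e * k) (d * e)))
    ∎)
  where
  solved : ∃[ c ] c < e × (∀ y → (+ e ∣ a ℤ.* y ℤ.- b) ⇔ (+ e ∣ y ℤ.- + c))
  solved = linear-congruence a e a⊥e b

  c : ℕ
  c = proj₁ solved

  c<e : c < e
  c<e = proj₁ (proj₂ solved)

  -- As y = c solves a y ≡ b (mod e), a common divisor of c and e divides b as well.
  c⊥e : Coprime c e
  c⊥e {g} (g∣c , g∣e) = b⊥e
    (∣⇒∣ᵤ (∣i-j∣i⇒∣j {+ g} (ℤ.∣-trans (∣ᵤ⇒∣ g∣e) e∣ac-b) (ℤ.∣n⇒∣m*n a (∣ᵤ⇒∣ g∣c))) , g∣e)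
    where
    e∣ac-b : + e ∣ a ℤ.* + c ℤ.- b
    e∣ac-b = from (proj₂ (proj₂ solved) (+ c)) (divides (+ 0) (ℤ.+-inverseʳ (+ c)))

  sol? : ∀ x → Dec ((+ (d * e) ∣ a ℤ.* + d ℤ.* + x ℤ.- b ℤ.* + d) × Coprime x (d * e))
  sol? x = (+ (d * e) ℤ.∣? a ℤ.* + d ℤ.* + x ℤ.- b ℤ.* + d) ×-dec coprime? x (d * e)

  congruence : ∀ x → (+ (d * e) ∣ a ℤ.* + d ℤ.* + x ℤ.- b ℤ.* + d) ⇔ (+ e ∣ + x ℤ.- + c)
  congruence x = subst (λ n → (+ n ∣ a ℤ.* + d ℤ.* + x ℤ.- b ℤ.* + d) ⇔ (+ e ∣ + x ℤ.- + c)) (ℕ.*-comm e d)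
    (proj₂ (proj₂ solved) (+ x) ⇔-∘ ∣-scale d (lemma a b (+ d) (+ x)))
    where
    lemma : ∀ a b d x → a ℤ.* d ℤ.* x ℤ.- b ℤ.* d ≡ (a ℤ.* x ℤ.- b) ℤ.* d
    lemma = solve-∀

-- Exact quotients, and the necessity of the two conditions.

[i/ℕt]*t≡i : ∀ i t .{{_ : NonZero t}} → + t ∣ i → i ≡ (i /ℕ t) ℤ.* + t
[i/ℕt]*t≡i i t t∣i = begin
  i                                       ≡⟨ a≡a%ℕn+[a/ℕn]*n i t ⟩
  + (i %ℕ t) ℤ.+ (i /ℕ t) ℤ.* + t         ≡⟨ cong (λ r → + r ℤ.+ (i /ℕ t) ℤ.* + t) i%t≡0 ⟩
  + 0 ℤ.+ (i /ℕ t) ℤ.* + t                ≡⟨ ℤ.+-identityˡ _ ⟩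
  (i /ℕ t) ℤ.* + t                        ∎
  where
  i%t≡0 : i %ℕ t ≡ 0
  i%t≡0 = residue-unique (n%ℕd<d i t) (ℕ.>-nonZero⁻¹ t)
    (subst (+ t ∣_) (sym (ℤ.+-identityʳ (+ (i %ℕ t))))
      (ℤ.∣m+n∣n⇒∣m (subst (+ t ∣_) (a≡a%ℕn+[a/ℕn]*n i t) t∣i) (ℤ.∣n⇒∣m*n (i /ℕ t) ℤ.∣-refl)))

coprime-quotient : ∀ a a′ {m d e} .{{_ : NonZero d}} →
                   ℕ.gcd ∣ a ∣ m ≡ d → a ≡ a′ ℤ.* + d → m ≡ d * e → Coprime ∣ a′ ∣ e
coprime-quotient a a′ {d = d} {e} gcd≡d refl refl = to (gcd≡⇔coprime ∣ a′ ∣ e d)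
  (trans (cong₂ ℕ.gcd (sym (ℤ.abs-* a′ (+ d))) (ℕ.*-comm e d)) gcd≡d)

-- A common divisor of a and m divides b = a y - (a y - b). Conversely (b , m) divides a y, and as a
-- divisor of m it is coprime to y, so it divides a.
gcd-congruent : ∀ a b m y → + m ∣ a ℤ.* y ℤ.- b → Coprime ∣ y ∣ m →
                (ℕ.gcd ∣ a ∣ m) ≡ (ℕ.gcd ∣ b ∣ m)
gcd-congruent a b m y m∣ay-b y⊥m = ℕ.∣-antisym
  (ℕ.gcd-greatest (∣⇒∣ᵤ h∣b) h∣m)
  (ℕ.gcd-greatest (Coprime.coprime-divisor g⊥y g∣y*a) g∣m)
  where
  gcd-∣ : ∀ i n → + (ℕ.gcd ∣ i ∣ n) ∣ i
  gcd-∣ i n = ∣ᵤ⇒∣ (ℕ.gcd[m,n]∣m ∣ i ∣ n)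

  g h : ℕ
  g = ℕ.gcd ∣ b ∣ m
  h = ℕ.gcd ∣ a ∣ m

  h∣m : h ℕ.∣ m
  h∣m = ℕ.gcd[m,n]∣n ∣ a ∣ m

  g∣m : g ℕ.∣ m
  g∣m = ℕ.gcd[m,n]∣n ∣ b ∣ m

  g⊥y : Coprime g ∣ y ∣
  g⊥y (h∣g , h∣y) = y⊥m (h∣y , ℕ.∣-trans h∣g g∣m)

  g∣y*a : g ℕ.∣ ∣ y ∣ * ∣ a ∣
  g∣y*a = subst (g ℕ.∣_) (trans (ℤ.abs-* a y) (ℕ.*-comm ∣ a ∣ ∣ y ∣))
    (∣⇒∣ᵤ {+ g} {a ℤ.* y} (ℤ.∣m+n∣n⇒∣m {m = a ℤ.* y} (ℤ.∣-trans (∣ᵤ⇒∣ g∣m) m∣ay-b)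
                                         (ℤ.∣m⇒∣-m (gcd-∣ b m))))

  h∣b : + h ∣ b
  h∣b = ∣i-j∣i⇒∣j (ℤ.∣-trans (∣ᵤ⇒∣ h∣m) m∣ay-b) (ℤ.∣m⇒∣m*n y (gcd-∣ a m))

-- As t divides x and n, it divides a x and a x - b.
solution⇒t∣b : ∀ a b n t x → IsSolution a b n t x → + t ∣ b
solution⇒t∣b a b n t x (n∣ax-b , gcd≡t) = ∣i-j∣i⇒∣j
  (ℤ.∣-trans (t∣ (ℕ.gcd[m,n]∣n ∣ x ∣ n)) n∣ax-b)
  (ℤ.∣n⇒∣m*n a (t∣ (ℕ.gcd[m,n]∣m ∣ x ∣ n)))
  where
  t∣ : ∀ {i} → (ℕ.gcd ∣ x ∣ n) ℕ.∣ (∣ i ∣) → + t ∣ i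
  t∣ {i} = ∣ᵤ⇒∣ ∘ subst (ℕ._∣ ∣ i ∣) (ℤ.+-injective gcd≡t)

necessary : ∀ a b n t .{{_ : NonZero n}} .{{_ : NonZero t}} x → IsSolution a b n t x →
            + t ∣ gcd b (+ n) × gcd a (+ (n / t)) ≡ gcd (b /ℕ t) (+ (n / t))
necessary a b n t x sol@(_ , gcd≡t) = ∣ᵤ⇒∣ (ℕ.gcd-greatest (∣⇒∣ᵤ t∣b) t∣n) ,
  cong +_ (gcd-congruent a (b /ℕ t) (n / t) y (proj₁ reduced) (proj₂ reduced))
  where
  t∣n : t ℕ.∣ n
  t∣n = subst (ℕ._∣ n) (ℤ.+-injective gcd≡t) (ℕ.gcd[m,n]∣n ∣ x ∣ n)

  t∣b : + t ∣ b
  t∣b = solution⇒t∣b a b n t x sol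

  t∣x : + t ∣ x
  t∣x = ∣ᵤ⇒∣ (subst (ℕ._∣ ∣ x ∣) (ℤ.+-injective gcd≡t) (ℕ.gcd[m,n]∣m ∣ x ∣ n))

  y : ℤ
  y = ℤ.quotient t∣x

  -- The numbers b, n and x are rewritten as explicit multiples of t, the shape that
  -- `isSolution-scale` expects.
  sol′ : IsSolution a ((b /ℕ t) ℤ.* + t) ((n / t) * t) t (y ℤ.* + t)
  sol′ = subst₂ (λ b n → IsSolution a b n t (y ℤ.* + t)) ([i/ℕt]*t≡i b t t∣b) (sym (m/n*n≡m t∣n))
    (subst (IsSolution a b n t) (_∣_.equality t∣x) sol)

  reduced : (+ (n / t) ∣ a ℤ.* y ℤ.- (b /ℕ t)) × Coprime ∣ y ∣ (n / t)
  reduced = to (isSolution-scale a (b /ℕ t) (n / t) t y) sol′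

-- The number of solutions when both conditions hold.

module _ (a b : ℤ) (d e t : ℕ) {n m : ℕ} .{{_ : NonZero d}} .{{_ : NonZero e}} .{{_ : NonZero t}}
         (n≡mt : n ≡ m * t) (m≡de : m ≡ d * e) (t∣b : + t ∣ b)
         (d≡gcd-a : ℕ.gcd ∣ a ∣ m ≡ d) (d≡gcd-b : ℕ.gcd ∣ b /ℕ t ∣ m ≡ d) where

  private
    d∣ : ∀ {i} → ℕ.gcd ∣ i ∣ m ≡ d → + d ∣ i
    d∣ {i} gcd≡d = ∣ᵤ⇒∣ (subst (ℕ._∣ ∣ i ∣) gcd≡d (ℕ.gcd[m,n]∣m ∣ i ∣ m))

    a′ b′ : ℤ
    a′ = ℤ.quotient (d∣ {a} d≡gcd-a)
    b′ = ℤ.quotient (d∣ {b /ℕ t} d≡gcd-b)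

    a≡a′d : a ≡ a′ ℤ.* + d
    a≡a′d = _∣_.equality (d∣ {a} d≡gcd-a)

    b/t≡b′d : b /ℕ t ≡ b′ ℤ.* + d
    b/t≡b′d = _∣_.equality (d∣ {b /ℕ t} d≡gcd-b)

    b≡b′dt : b ≡ b′ ℤ.* + d ℤ.* + t
    b≡b′dt = trans ([i/ℕt]*t≡i b t t∣b) (cong (ℤ._* + t) b/t≡b′d)

    residue : ∃[ c ] Coprime c e ×
      #solutions (a′ ℤ.* + d) (b′ ℤ.* + d ℤ.* + t) (d * e * t) t ≡
      Σ d (λ k → 𝟙 (coprime? (c + e * k) (d * e)))
    residue = #solutions-residue a′ b′ d e t
      (coprime-quotient a a′ d≡gcd-a a≡a′d m≡de)
      (coprime-quotient (b /ℕ t) b′ d≡gcd-b b/t≡b′d m≡de)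

    #≡Σ : #solutions a b n t ≡ Σ d (λ k → 𝟙 (coprime? (proj₁ residue + e * k) (d * e)))
    #≡Σ = trans
      (trans (cong₂ (λ a b → #solutions a b n t) a≡a′d b≡b′dt)
             (cong (λ n → #solutions (a′ ℤ.* + d) (b′ ℤ.* + d ℤ.* + t) n t)
                   (trans n≡mt (cong (_* t) m≡de))))
      (proj₂ (proj₂ residue))

  -- By `#≡Σ` the number of solutions is the count for one class c coprime to e, which is the
  -- cofactor of φ(e) in `φ-*` for the same c.
  φ≡φ*#solutions : φ m ≡ φ e * #solutions a b n t
  φ≡φ*#solutions = trans (cong φ m≡de)
    (trans (φ-* d e (proj₁ (proj₂ residue))) (cong (φ e *_) (sym #≡Σ)))

  #solutions≡d*∏ : ι (#solutions a b n t) ≡ ι d ℚ.* ∏[1-1/p] d e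
  #solutions≡d*∏ = trans (cong ι #≡Σ) (count-coprime d e (proj₁ (proj₂ residue)))

theorem3p1 : (a b : ℤ) (n t : ℕ) .{{_ : NonZero n}} .{{_ : NonZero t}} →
    ((∃[ x ] IsSolution a b n t x) ⇔
      (+ t ∣ gcd b (+ n) × gcd a (+ (n / t)) ≡ gcd (b /ℕ t) (+ (n / t))))
    ×
    ((t∣[b,n] : + t ∣ gcd b (+ n)) →
     gcd a (+ (n / t)) ≡ gcd (b /ℕ t) (+ (n / t)) →
     let d = ∣ gcd a (+ (n / t)) ∣
         instance _ = t*d≢0 a (∣[b,n]⇒∣n b t∣[b,n])
         instance _ = n/[t*d]≢0 a (∣[b,n]⇒∣n b t∣[b,n])
         instance _ = φ≢0 (n / (t * d))
     in (+ #solutions a b n t ℚ./ 1 ≡ + φ (n / t) ℚ./ φ (n / (t * d)))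
        × (+ φ (n / t) ℚ./ φ (n / (t * d))
            ≡ (+ d ℚ./ 1) ℚ.* ∏[1-1/p] d (n / (t * d))))
theorem3p1 a b n t =
  mk⇔ (λ (x , sol) → necessary a b n t x sol)
      (λ (t∣[b,n] , gcds≡) → Counting.solution t∣[b,n] gcds≡) ,
  λ t∣[b,n] gcds≡ → Counting.#≡quotient t∣[b,n] gcds≡ , Counting.quotient≡d*∏ t∣[b,n] gcds≡
  where
  module Counting (t∣[b,n] : + t ∣ gcd b (+ n))
                  (gcds≡ : gcd a (+ (n / t)) ≡ gcd (b /ℕ t) (+ (n / t))) where
    t∣n : t ℕ.∣ n
    t∣n = ∣[b,n]⇒∣n b t∣[b,n]

    t∣b : + t ∣ b
    t∣b = ℤ.∣-trans t∣[b,n] (∣ᵤ⇒∣ (ℕ.gcd[m,n]∣m ∣ b ∣ n))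

    m d : ℕ
    m = n / t
    d = ℕ.gcd ∣ a ∣ m

    instance
      m≢0 : NonZero m
      m≢0 = n/t≢0 t∣n

      d≢0 : NonZero d
      d≢0 = ℕ.≢-nonZero (ℕ.gcd[m,n]≢0 ∣ a ∣ m (inj₂ (ℕ.≢-nonZero⁻¹ m)))

      td≢0 : NonZero (t * d)
      td≢0 = t*d≢0 a t∣n

    e : ℕ
    e = n / (t * d)

    instance
      e≢0 : NonZero e
      e≢0 = n/[t*d]≢0 a t∣n

      φe≢0 : NonZero (φ e)
      φe≢0 = φ≢0 e

    m≡de : m ≡ d * e
    m≡de = begin
      m              ≡⟨ m*[n/m]≡n (ℕ.gcd[m,n]∣n ∣ a ∣ m) ⟨
      d * (m / d)    ≡⟨ cong (d *_) (m/n/o≡m/[n*o] n t d) ⟩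
      d * e          ∎

    φm≡φe*# : φ m ≡ φ e * #solutions a b n t
    -- `d` is (a , m) by definition, hence `refl`; that it is also (b/t , m) is the hypothesis
    -- `gcds≡`.
    φm≡φe*# = φ≡φ*#solutions a b d e t (sym (m/n*n≡m t∣n)) m≡de t∣b refl (sym (ℤ.+-injective gcds≡))

    #≡quotient : + #solutions a b n t ℚ./ 1 ≡ + φ m ℚ./ φ e
    #≡quotient = sym (/-≡ι φm≡φe*#)

    quotient≡d*∏ : + φ m ℚ./ φ e ≡ (+ d ℚ./ 1) ℚ.* ∏[1-1/p] d e
    quotient≡d*∏ = trans (sym #≡quotient)
      (#solutions≡d*∏ a b d e t (sym (m/n*n≡m t∣n)) m≡de t∣b refl (sym (ℤ.+-injective gcds≡)))

    -- Existence is read off the count: φ(m) is nonzero and a multiple of the number of solutions,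
    -- so that number is not 0.
    solution : ∃[ x ] IsSolution a b n t x
    solution = let (r , sol) = length-filter≢0 (λ (r : Fin n) → isSolution? a b n t (+ toℕ r)) (allFin n) #≢0
               in + toℕ r , sol
      where
      #≢0 : #solutions a b n t ≢ 0
      #≢0 #≡0 = ℕ.≢-nonZero⁻¹ (φ m) {{φ≢0 m}}
        (trans φm≡φe*# (trans (cong (φ e *_) #≡0) (ℕ.*-zeroʳ (φ e))))
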